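{- For every bunch of formulae $\Gamma \in \mathcal{B}(\mathbb{F})$ and every formula $\varphi \in \mathbb{F}$: if $\Gamma \Vdash \varphi$ (i.e. the sequent $\Gamma\triangleright\varphi$ is valid in the base-extension semantics), then $\Gamma \vdash \varphi$ (i.e. the sequent $\Gamma \triangleright \varphi$ is provable in the natural deduction system $\mathsf{NBI}$).
   Context: **Syntax.** Fix a denumerable (countably infinite) set $\mathbb{A}$ of atoms. The set $\mathbb{F}$ of formulae of the logic of bunched implications (BI) is generated by $\varphi ::= p\in\mathbb{A} \mid \top \mid \bot \mid \top^{\ast} \mid \varphi\land\varphi \mid \varphi\lor\varphi \mid \varphi\to\varphi \mid \varphi\ast\varphi \mid \varphi\mathbin{ -\!\ast}\varphi$. For a set $X$, the set $\mathcal{B}(X)$ of bunches over $X$ is generated by $\Gamma ::= x\in X \mid \varnothing_{+} \mid \varnothing_{\times} \mid (\Gamma ; \Gamma) \mid (\Gamma , \Gamma)$; here $;$ is the additive context-former with unit $\varnothing_+$, and $,$ is the multiplicative context-former with unit $\varnothing_\times$. $\Gamma(\Delta)$ denotes a bunch with a distinguished sub-bunch occurrence $\Delta$, and $\Gamma(\Delta')$ the result of replacing that occurrence by $\Delta'$. A contextual bunch over $X$ is a function $\mathcal{B}(X)\to\mathcal{B}(X)$ of the form $\Sigma\mapsto\Gamma(\Sigma)$ (equivalently, a bunch with exactly one hole), written $\Gamma(\cdot)$; the set of these is $\dot{\mathcal{B}}(X)$, and $(\cdot)$ denotes the identity. Coherent equivalence $\equiv$ is the least equivalence relation on $\mathcal{B}(X)$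 containing the commutative monoid equations for $;$ with unit $\varnothing_+$ and for $,$ with unit $\varnothing_\times$, and such that $\Delta\equiv\Delta'$ implies $\Gamma(\Delta)\equiv\Gamma(\Delta')$. **System $\mathsf{NBI}$.** A sequent is a pair $\Gamma\triangleright\varphi$ with $\Gamma\in\mathcal{B}(\mathbb{F})$, $\varphi\in\mathbb{F}$. $\Gamma\vdash\varphi$ means $\Gamma\triangleright\varphi$ is derivable by the rules (premisses $\Rightarrow$ conclusion): $\Rightarrow \varphi\triangleright\varphi$; $\Gamma'\triangleright\varphi \Rightarrow \Gamma\triangleright\varphi$ if $\Gamma\equiv\Gamma'$; $\Gamma(\Delta)\triangleright\varphi \Rightarrow \Gamma(\Delta;\Delta')\triangleright\varphi$; $\Gamma(\Delta;\Delta)\triangleright\varphi \Rightarrow \Gamma(\Delta)\triangleright\varphi$; $\Rightarrow \varnothing_\times\triangleright\top^\ast$; [$\Gamma(\varnothing_\times)\triangleright\chi$ and $\Delta\triangleright\top^\ast$] $\Rightarrow \Gamma(\Delta)\triangleright\chi$; $(\Gamma,\varphi)\triangleright\psi \Rightarrow \Gamma\triangleright\varphi\mathbin{ -\!\ast}\psi$; [$\Gamma\triangleright\varphi\mathbin{ -\!\ast}\psi$ and $\Delta\triangleright\varphi$] $\Rightarrow (\Gamma,\Delta)\triangleright\psi$; [$\Gamma\triangleright\varphi$ and $\Delta\triangleright\psi$] $\Rightarrow (\Gamma,\Delta)\triangleright\varphi\ast\psi$; [$\Gamma(\varphi,\psi)\triangleright\chi$ and $\Delta\triangleright\varphi\ast\psi$]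 $\Rightarrow \Gamma(\Delta)\triangleright\chi$; $\Rightarrow \varnothing_+\triangleright\top$; [$\Gamma(\varnothing_+)\triangleright\chi$ and $\Delta\triangleright\top$] $\Rightarrow \Gamma(\Delta)\triangleright\chi$; $(\Gamma;\varphi)\triangleright\psi \Rightarrow \Gamma\triangleright\varphi\to\psi$; [$\Gamma\triangleright\varphi\to\psi$ and $\Delta\triangleright\varphi$] $\Rightarrow (\Gamma;\Delta)\triangleright\psi$; [$\Gamma\triangleright\varphi$ and $\Delta\triangleright\psi$] $\Rightarrow (\Gamma;\Delta)\triangleright\varphi\land\psi$; [$\Gamma(\varphi;\psi)\triangleright\chi$ and $\Delta\triangleright\varphi\land\psi$] $\Rightarrow \Gamma(\Delta)\triangleright\chi$; $\Gamma\triangleright\varphi_i \Rightarrow \Gamma\triangleright\varphi_1\lor\varphi_2$ ($i\in\{1,2\}$); [$\Gamma(\varphi)\triangleright\chi$ and $\Gamma(\psi)\triangleright\chi$ and $\Delta\triangleright\varphi\lor\psi$] $\Rightarrow \Gamma(\Delta)\triangleright\chi$; $\Gamma\triangleright\bot \Rightarrow \Gamma\triangleright\varphi$. **Bases.** An atomic rule is a pair consisting of a finite (possibly empty) set of premisses $P_1\triangleright p_1,\dots,P_n\triangleright p_n$ and a conclusion $P\triangleright p$, with $P_i,P\in\mathcal{B}(\mathbb{A})$, $p_i,p\in\mathbb{A}$; rules are not closed under substitution. A base is a set of atomic rules; $\mathscr{C}$ extends $\mathscr{B}$ when $\mathscr{C}\supseteq\mathscr{B}$. Derivability $\vdash_{\mathscr{B}}$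 is the smallest relation between $\mathcal{B}(\mathbb{A})$ and $\mathbb{A}$ such that: $p\vdash_{\mathscr{B}}p$; if a rule of $\mathscr{B}$ has premisses $P_i\triangleright p_i$ ($i=1,\dots,n$, $n\ge 0$) and conclusion $P\triangleright p$, and $P_i\vdash_{\mathscr{B}}p_i$ for all $i$, then $P\vdash_{\mathscr{B}}p$; if $P(Q)\vdash_{\mathscr{B}}p$ then $P(Q;Q')\vdash_{\mathscr{B}}p$ for any $Q'\in\mathcal{B}(\mathbb{A})$; if $P(Q;Q)\vdash_{\mathscr{B}}p$ then $P(Q)\vdash_{\mathscr{B}}p$; if $P(Q)\vdash_{\mathscr{B}}p$ and $Q\equiv Q'$ then $P(Q')\vdash_{\mathscr{B}}p$; if $T\vdash_{\mathscr{B}}q$ and $S(q)\vdash_{\mathscr{B}}p$ then $S(T)\vdash_{\mathscr{B}}p$. **Bunch-extension.** $\succeq$ is the least transitive relation on bunches such that $\Gamma\succeq\Gamma'$ whenever $\Gamma$ is coherently equivalent to the result of replacing some sub-bunch occurrence $\Delta$ of $\Gamma'$ by $(\Delta;\Delta')$, for some bunch $\Delta'$. $\Gamma'\preceq\Gamma$ means $\Gamma\succeq\Gamma'$. **Support.** For a base $\mathscr{B}$, $S\in\mathcal{B}(\mathbb{A})$ and $R(\cdot)\in\dot{\mathcal{B}}(\mathbb{A})$, support of formulae, of bunches of formulae, and of sequents is defined inductively ($\mathscr{X}$ ranges over bases, $U(\cdot)$ over $\dot{\mathcal{B}}(\mathbb{A})$, $U,Q_1,Q_2$ over $\mathcal{B}(\mathbb{A})$,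 $p$ over $\mathbb{A}$): - $\Vdash^{S}_{\mathscr{B}}p$ iff $S\vdash_{\mathscr{B}}p$; - $\Vdash^{S}_{\mathscr{B}}\varphi\land\psi$ iff for all $\mathscr{X}\supseteq\mathscr{B}$, $U(\cdot)$, $p$: if $(\varphi;\psi)\Vdash^{U(\cdot)}_{\mathscr{X}}p$ then $\Vdash^{U(S)}_{\mathscr{X}}p$; - $\Vdash^{S}_{\mathscr{B}}\varphi\ast\psi$ iff for all $\mathscr{X}\supseteq\mathscr{B}$, $U(\cdot)$, $p$: if $(\varphi,\psi)\Vdash^{U(\cdot)}_{\mathscr{X}}p$ then $\Vdash^{U(S)}_{\mathscr{X}}p$; - $\Vdash^{S}_{\mathscr{B}}\varphi\lor\psi$ iff for all $\mathscr{X}\supseteq\mathscr{B}$, $U(\cdot)$, $p$: if $\varphi\Vdash^{U(\cdot)}_{\mathscr{X}}p$ and $\psi\Vdash^{U(\cdot)}_{\mathscr{X}}p$ then $\Vdash^{U(S)}_{\mathscr{X}}p$; - $\Vdash^{S}_{\mathscr{B}}\varphi\to\psi$ iff $\varphi\Vdash^{S;(\cdot)}_{\mathscr{B}}\psi$; - $\Vdash^{S}_{\mathscr{B}}\varphi\mathbin{ -\!\ast}\psi$ iff $\varphi\Vdash^{S,(\cdot)}_{\mathscr{B}}\psi$; - $\Vdash^{S}_{\mathscr{B}}\bot$ iff for all $U(\cdot)$ and $p$: $\Vdash^{U(S)}_{\mathscr{B}}p$; - $\Vdash^{S}_{\mathscr{B}}\top$ iff for all $\mathscr{X}\supseteq\mathscr{B}$,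 $U(\cdot)$, $p$: if $\Vdash^{U(\varnothing_+)}_{\mathscr{X}}p$ then $\Vdash^{U(S)}_{\mathscr{X}}p$; - $\Vdash^{S}_{\mathscr{B}}\top^\ast$ iff for all $\mathscr{X}\supseteq\mathscr{B}$, $U(\cdot)$, $p$: if $\Vdash^{U(\varnothing_\times)}_{\mathscr{X}}p$ then $\Vdash^{U(S)}_{\mathscr{X}}p$; - $\Gamma\Vdash^{R(\cdot)}_{\mathscr{B}}\psi$ iff for all $\mathscr{X}\supseteq\mathscr{B}$ and $U$: if $\Vdash^{U}_{\mathscr{X}}\Gamma$ then $\Vdash^{R(U)}_{\mathscr{X}}\psi$; - $\Vdash^{S}_{\mathscr{B}}\varnothing_\times$ iff $S\succeq\varnothing_\times$; - $\Vdash^{S}_{\mathscr{B}}\varnothing_+$ always; - $\Vdash^{S}_{\mathscr{B}}(\Gamma,\Delta)$ iff there are $Q_1,Q_2$ with $S\succeq(Q_1,Q_2)$, $\Vdash^{Q_1}_{\mathscr{B}}\Gamma$ and $\Vdash^{Q_2}_{\mathscr{B}}\Delta$; - $\Vdash^{S}_{\mathscr{B}}(\Gamma;\Delta)$ iff there are $Q_1,Q_2$ with $S\succeq Q_1$, $S\succeq Q_2$, $\Vdash^{Q_1}_{\mathscr{B}}\Gamma$ and $\Vdash^{Q_2}_{\mathscr{B}}\Delta$. **Validity.** $\Gamma\Vdash\varphi$ iff $\Gamma\Vdash^{(\cdot)}_{\mathscr{B}}\varphi$ for every base $\mathscr{B}$. -}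

module Defs where

open import Data.List.Base using (List)
open import Data.List.Membership.Propositional using () renaming (_∈_ to _∈ˡ_)
open import Data.Product using (_×_; ∃₂)
open import Data.Unit.Base using () renaming (⊤ to Unit)
open import Level using (Lift; 0ℓ; suc)
open import Relation.Binary.Construct.Closure.Transitive using (TransClosure)
open import Relation.Binary.PropositionalEquality using (_≡_; refl)
open import Relation.Unary using (Pred; _∈_; _⊆_)

infixr 7 _∧_ _∗_
infixr 6 _∨_
infixr 5 _⇒_ _-∗_
infixr 4 _⨾_ _⸴_
infix  8 _[_]
infix  3 _≈_ _≽₁_ _≽_ _▹_
infix  2 _⊢_ _⊢⟨_⟩_

data Formula (𝔸 : Set) : Set where
  atom             : 𝔸 → Formula 𝔸
  ⊤ ⊥ ⊤∗           : Formula 𝔸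
  _∧_ _∨_ _⇒_      : Formula 𝔸 → Formula 𝔸 → Formula 𝔸
  _∗_ _-∗_         : Formula 𝔸 → Formula 𝔸 → Formula 𝔸

-- `_⨾_` (unit `∅₊`) is the additive context-former, written ";" on paper;
-- `_⸴_` (unit `∅ₓ`) is the multiplicative one, written ",".
data Bunch (X : Set) : Set where
  ⌞_⌟     : X → Bunch X
  ∅₊ ∅ₓ   : Bunch X
  _⨾_ _⸴_ : Bunch X → Bunch X → Bunch X

-- Contextual bunches, as bunches with exactly one hole.  A bunch Γ(Δ) with a
-- distinguished occurrence of Δ is `C [ Δ ]` for a contextual bunch C.
data Ctx (X : Set) : Set where
  ∙         : Ctx X
  _⨾ˡ_ _⸴ˡ_ : Ctx X → Bunch X → Ctx X
  _⨾ʳ_ _⸴ʳ_ : Bunch X → Ctx X → Ctx X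

_[_] : ∀ {X} → Ctx X → Bunch X → Bunch X
∙        [ Σ ] = Σ
(C ⨾ˡ Δ) [ Σ ] = C [ Σ ] ⨾ Δ
(C ⸴ˡ Δ) [ Σ ] = C [ Σ ] ⸴ Δ
(Δ ⨾ʳ C) [ Σ ] = Δ ⨾ C [ Σ ]
(Δ ⸴ʳ C) [ Σ ] = Δ ⸴ C [ Σ ]

-- The equivalence usually written ≡ (coherent equivalence).
data _≈_ {X : Set} : Bunch X → Bunch X → Set where
  ≈-refl  : ∀ {Γ} → Γ ≈ Γ
  ≈-sym   : ∀ {Γ Δ} → Γ ≈ Δ → Δ ≈ Γ
  ≈-trans : ∀ {Γ Δ Θ} → Γ ≈ Δ → Δ ≈ Θ → Γ ≈ Θ
  ⨾-comm  : ∀ {Γ Δ} → Γ ⨾ Δ ≈ Δ ⨾ Γ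
  ⨾-assoc : ∀ {Γ Δ Θ} → (Γ ⨾ Δ) ⨾ Θ ≈ Γ ⨾ (Δ ⨾ Θ)
  ⨾-unit  : ∀ {Γ} → Γ ⨾ ∅₊ ≈ Γ
  ⸴-comm  : ∀ {Γ Δ} → Γ ⸴ Δ ≈ Δ ⸴ Γ
  ⸴-assoc : ∀ {Γ Δ Θ} → (Γ ⸴ Δ) ⸴ Θ ≈ Γ ⸴ (Δ ⸴ Θ)
  ⸴-unit  : ∀ {Γ} → Γ ⸴ ∅ₓ ≈ Γ
  ≈-cong  : ∀ (C : Ctx X) {Δ Δ′} → Δ ≈ Δ′ → C [ Δ ] ≈ C [ Δ′ ]

data _≽₁_ {X : Set} : Bunch X → Bunch X → Set where
  extend : ∀ (C : Ctx X) {Γ Δ} Δ′ → Γ ≈ C [ Δ ⨾ Δ′ ] → Γ ≽₁ C [ Δ ]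

_≽_ : ∀ {X} → Bunch X → Bunch X → Set
_≽_ = TransClosure _≽₁_

data _⊢_ {𝔸 : Set} : Bunch (Formula 𝔸) → Formula 𝔸 → Set where
  ax     : ∀ {φ} → ⌞ φ ⌟ ⊢ φ
  exch   : ∀ {Γ Γ′ φ} → Γ ≈ Γ′ → Γ′ ⊢ φ → Γ ⊢ φ
  weak   : ∀ C {Δ Δ′ φ} → C [ Δ ] ⊢ φ → C [ Δ ⨾ Δ′ ] ⊢ φ
  contr  : ∀ C {Δ φ} → C [ Δ ⨾ Δ ] ⊢ φ → C [ Δ ] ⊢ φ
  ⊤∗-I   : ∅ₓ ⊢ ⊤∗
  ⊤∗-E   : ∀ C {Δ χ} → C [ ∅ₓ ] ⊢ χ → Δ ⊢ ⊤∗ → C [ Δ ] ⊢ χ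
  -∗-I   : ∀ {Γ φ ψ} → Γ ⸴ ⌞ φ ⌟ ⊢ ψ → Γ ⊢ φ -∗ ψ
  -∗-E   : ∀ {Γ Δ φ ψ} → Γ ⊢ φ -∗ ψ → Δ ⊢ φ → Γ ⸴ Δ ⊢ ψ
  ∗-I    : ∀ {Γ Δ φ ψ} → Γ ⊢ φ → Δ ⊢ ψ → Γ ⸴ Δ ⊢ φ ∗ ψ
  ∗-E    : ∀ C {Δ φ ψ χ} → C [ ⌞ φ ⌟ ⸴ ⌞ ψ ⌟ ] ⊢ χ → Δ ⊢ φ ∗ ψ → C [ Δ ] ⊢ χ
  ⊤-I    : ∅₊ ⊢ ⊤
  ⊤-E    : ∀ C {Δ χ} → C [ ∅₊ ] ⊢ χ → Δ ⊢ ⊤ → C [ Δ ] ⊢ χ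
  ⇒-I    : ∀ {Γ φ ψ} → Γ ⨾ ⌞ φ ⌟ ⊢ ψ → Γ ⊢ φ ⇒ ψ
  ⇒-E    : ∀ {Γ Δ φ ψ} → Γ ⊢ φ ⇒ ψ → Δ ⊢ φ → Γ ⨾ Δ ⊢ ψ
  ∧-I    : ∀ {Γ Δ φ ψ} → Γ ⊢ φ → Δ ⊢ ψ → Γ ⨾ Δ ⊢ φ ∧ ψ
  ∧-E    : ∀ C {Δ φ ψ χ} → C [ ⌞ φ ⌟ ⨾ ⌞ ψ ⌟ ] ⊢ χ → Δ ⊢ φ ∧ ψ → C [ Δ ] ⊢ χ
  ∨-I₁   : ∀ {Γ φ ψ} → Γ ⊢ φ → Γ ⊢ φ ∨ ψ
  ∨-I₂   : ∀ {Γ φ ψ} → Γ ⊢ ψ → Γ ⊢ φ ∨ ψ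
  ∨-E    : ∀ C {Δ φ ψ χ} → C [ ⌞ φ ⌟ ] ⊢ χ → C [ ⌞ ψ ⌟ ] ⊢ χ → Δ ⊢ φ ∨ ψ →
           C [ Δ ] ⊢ χ
  ⊥-E    : ∀ {Γ φ} → Γ ⊢ ⊥ → Γ ⊢ φ

record AtomicSequent (𝔸 : Set) : Set where
  constructor _▹_
  field
    antecedent : Bunch 𝔸
    succedent  : 𝔸

-- The finite set of premisses is presented by a list; only membership in the
-- list is ever used.
record AtomicRule (𝔸 : Set) : Set where
  constructor _⟹_
  field
    premisses  : List (AtomicSequent 𝔸)
    conclusion : AtomicSequent 𝔸

-- A base is a set of atomic rules; 𝒳 extends ℬ when ℬ ⊆ 𝒳.
Base : Set → Set₁
Base 𝔸 = Pred (AtomicRule 𝔸) 0ℓ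

module _ {𝔸 : Set} (ℬ : Base 𝔸) where

  data Derivable : Bunch 𝔸 → 𝔸 → Set where
    ref   : ∀ {p} → Derivable ⌞ p ⌟ p
    rule  : ∀ {prems P p} → (prems ⟹ (P ▹ p)) ∈ ℬ →
            (∀ {Q q} → (Q ▹ q) ∈ˡ prems → Derivable Q q) → Derivable P p
    weak  : ∀ P {Q Q′ p} → Derivable (P [ Q ]) p → Derivable (P [ Q ⨾ Q′ ]) p
    contr : ∀ P {Q p} → Derivable (P [ Q ⨾ Q ]) p → Derivable (P [ Q ]) p
    exch  : ∀ P {Q Q′ p} → Derivable (P [ Q ]) p → Q ≈ Q′ → Derivable (P [ Q′ ]) p
    cut   : ∀ S {T p q} → Derivable T q → Derivable (S [ ⌞ q ⌟ ]) p →
            Derivable (S [ T ]) p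

_⊢⟨_⟩_ : ∀ {𝔸} → Bunch 𝔸 → Base 𝔸 → 𝔸 → Set
S ⊢⟨ ℬ ⟩ p = Derivable ℬ S p

-- The judgements ⊩ᶠ[ S ∣ ℬ ] φ, ⊩ᵇ[ S ∣ ℬ ] Γ and Γ ⊩[ R ∣ ℬ ] ψ carry the atomic
-- (contextual) bunch, then the base, which on paper are super- and subscripts of ⊩.
--
-- Support is defined compositionally: `Supp` is the type of "being supported at
-- a base ℬ and an atomic bunch S", and the operations below give the clauses
-- for atoms, for bunches and for sequents on such predicates.  Defining the
-- clauses for formulae directly by way of bunches such as ⌞ φ ⌟ ⨾ ⌞ ψ ⌟ would not
-- be structurally recursive; the equations at the end, which hold by `refl`, show
-- that the clauses in that form are recovered.
Supp : Set → Set₂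
Supp 𝔸 = Base 𝔸 → Bunch 𝔸 → Set₁

module _ {𝔸 : Set} where

  infixr 4 _⨾ˢ_ _⸴ˢ_
  infix  2 _⊩_ _⊩[_∣_]_ ⊩ᶠ[_∣_]_ ⊩ᵇ[_∣_]_

  atomˢ : 𝔸 → Supp 𝔸
  atomˢ p ℬ S = Lift (suc 0ℓ) (S ⊢⟨ ℬ ⟩ p)

  ∅₊ˢ : Supp 𝔸
  ∅₊ˢ ℬ S = Lift (suc 0ℓ) Unit

  ∅ₓˢ : Supp 𝔸
  ∅ₓˢ ℬ S = Lift (suc 0ℓ) (S ≽ ∅ₓ)

  _⨾ˢ_ : Supp 𝔸 → Supp 𝔸 → Supp 𝔸
  (G ⨾ˢ D) ℬ S = ∃₂ λ Q₁ Q₂ → S ≽ Q₁ × S ≽ Q₂ × G ℬ Q₁ × D ℬ Q₂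

  _⸴ˢ_ : Supp 𝔸 → Supp 𝔸 → Supp 𝔸
  (G ⸴ˢ D) ℬ S = ∃₂ λ Q₁ Q₂ → S ≽ Q₁ ⸴ Q₂ × G ℬ Q₁ × D ℬ Q₂

  Seqˢ : Supp 𝔸 → Ctx 𝔸 → Base 𝔸 → Supp 𝔸 → Set₁
  Seqˢ G R ℬ F = ∀ 𝒳 → ℬ ⊆ 𝒳 → ∀ U → G 𝒳 U → F 𝒳 (R [ U ])

  ⊩ᶠ[_∣_]_ : Bunch 𝔸 → Base 𝔸 → Formula 𝔸 → Set₁

  ⟦_⟧ᶠ : Formula 𝔸 → Supp 𝔸
  ⟦ φ ⟧ᶠ ℬ S = ⊩ᶠ[ S ∣ ℬ ] φ

  ⊩ᶠ[ S ∣ ℬ ] atom p = atomˢ p ℬ S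
  ⊩ᶠ[ S ∣ ℬ ] φ ∧ ψ  = ∀ 𝒳 → ℬ ⊆ 𝒳 → ∀ U p →
    Seqˢ (⟦ φ ⟧ᶠ ⨾ˢ ⟦ ψ ⟧ᶠ) U 𝒳 (atomˢ p) → atomˢ p 𝒳 (U [ S ])
  ⊩ᶠ[ S ∣ ℬ ] φ ∗ ψ  = ∀ 𝒳 → ℬ ⊆ 𝒳 → ∀ U p →
    Seqˢ (⟦ φ ⟧ᶠ ⸴ˢ ⟦ ψ ⟧ᶠ) U 𝒳 (atomˢ p) → atomˢ p 𝒳 (U [ S ])
  ⊩ᶠ[ S ∣ ℬ ] φ ∨ ψ  = ∀ 𝒳 → ℬ ⊆ 𝒳 → ∀ U p →
    Seqˢ ⟦ φ ⟧ᶠ U 𝒳 (atomˢ p) → Seqˢ ⟦ ψ ⟧ᶠ U 𝒳 (atomˢ p) → atomˢ p 𝒳 (U [ S ])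
  ⊩ᶠ[ S ∣ ℬ ] φ ⇒ ψ  = Seqˢ ⟦ φ ⟧ᶠ (S ⨾ʳ ∙) ℬ ⟦ ψ ⟧ᶠ
  ⊩ᶠ[ S ∣ ℬ ] φ -∗ ψ = Seqˢ ⟦ φ ⟧ᶠ (S ⸴ʳ ∙) ℬ ⟦ ψ ⟧ᶠ
  ⊩ᶠ[ S ∣ ℬ ] ⊥      = ∀ U p → atomˢ p ℬ (U [ S ])
  ⊩ᶠ[ S ∣ ℬ ] ⊤      = ∀ 𝒳 → ℬ ⊆ 𝒳 → ∀ U p →
    atomˢ p 𝒳 (U [ ∅₊ ]) → atomˢ p 𝒳 (U [ S ])
  ⊩ᶠ[ S ∣ ℬ ] ⊤∗     = ∀ 𝒳 → ℬ ⊆ 𝒳 → ∀ U p →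
    atomˢ p 𝒳 (U [ ∅ₓ ]) → atomˢ p 𝒳 (U [ S ])

  ⟦_⟧ᵇ : Bunch (Formula 𝔸) → Supp 𝔸
  ⟦ ⌞ φ ⌟ ⟧ᵇ = ⟦ φ ⟧ᶠ
  ⟦ ∅₊    ⟧ᵇ = ∅₊ˢ
  ⟦ ∅ₓ    ⟧ᵇ = ∅ₓˢ
  ⟦ Γ ⨾ Δ ⟧ᵇ = ⟦ Γ ⟧ᵇ ⨾ˢ ⟦ Δ ⟧ᵇ
  ⟦ Γ ⸴ Δ ⟧ᵇ = ⟦ Γ ⟧ᵇ ⸴ˢ ⟦ Δ ⟧ᵇ

  ⊩ᵇ[_∣_]_ : Bunch 𝔸 → Base 𝔸 → Bunch (Formula 𝔸) → Set₁
  ⊩ᵇ[ S ∣ ℬ ] Γ = ⟦ Γ ⟧ᵇ ℬ S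

  _⊩[_∣_]_ : Bunch (Formula 𝔸) → Ctx 𝔸 → Base 𝔸 → Formula 𝔸 → Set₁
  Γ ⊩[ R ∣ ℬ ] ψ = Seqˢ ⟦ Γ ⟧ᵇ R ℬ ⟦ ψ ⟧ᶠ

  _⊩_ : Bunch (Formula 𝔸) → Formula 𝔸 → Set₁
  Γ ⊩ φ = ∀ ℬ → Γ ⊩[ ∙ ∣ ℬ ] φ

  module _ {ℬ : Base 𝔸} {S : Bunch 𝔸} {φ ψ : Formula 𝔸} where

    ⊩-∧ : (⊩ᶠ[ S ∣ ℬ ] φ ∧ ψ) ≡ (∀ 𝒳 → ℬ ⊆ 𝒳 → ∀ U p →
          ⌞ φ ⌟ ⨾ ⌞ ψ ⌟ ⊩[ U ∣ 𝒳 ] atom p → ⊩ᶠ[ U [ S ] ∣ 𝒳 ] atom p)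
    ⊩-∧ = refl

    ⊩-∗ : (⊩ᶠ[ S ∣ ℬ ] φ ∗ ψ) ≡ (∀ 𝒳 → ℬ ⊆ 𝒳 → ∀ U p →
          ⌞ φ ⌟ ⸴ ⌞ ψ ⌟ ⊩[ U ∣ 𝒳 ] atom p → ⊩ᶠ[ U [ S ] ∣ 𝒳 ] atom p)
    ⊩-∗ = refl

    ⊩-∨ : (⊩ᶠ[ S ∣ ℬ ] φ ∨ ψ) ≡ (∀ 𝒳 → ℬ ⊆ 𝒳 → ∀ U p →
          ⌞ φ ⌟ ⊩[ U ∣ 𝒳 ] atom p → ⌞ ψ ⌟ ⊩[ U ∣ 𝒳 ] atom p →
          ⊩ᶠ[ U [ S ] ∣ 𝒳 ] atom p)
    ⊩-∨ = refl

    ⊩-⇒ : (⊩ᶠ[ S ∣ ℬ ] φ ⇒ ψ) ≡ (⌞ φ ⌟ ⊩[ S ⨾ʳ ∙ ∣ ℬ ] ψ)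
    ⊩-⇒ = refl

    ⊩--∗ : (⊩ᶠ[ S ∣ ℬ ] φ -∗ ψ) ≡ (⌞ φ ⌟ ⊩[ S ⸴ʳ ∙ ∣ ℬ ] ψ)
    ⊩--∗ = refl

  module _ {ℬ : Base 𝔸} where

    ⊩-⨾ : ∀ {S Γ Δ} → (⊩ᵇ[ S ∣ ℬ ] Γ ⨾ Δ) ≡ (∃₂ λ Q₁ Q₂ →
          S ≽ Q₁ × S ≽ Q₂ × (⊩ᵇ[ Q₁ ∣ ℬ ] Γ) × (⊩ᵇ[ Q₂ ∣ ℬ ] Δ))
    ⊩-⨾ = refl

    ⊩-⸴ : ∀ {S Γ Δ} → (⊩ᵇ[ S ∣ ℬ ] Γ ⸴ Δ) ≡ (∃₂ λ Q₁ Q₂ →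
          S ≽ Q₁ ⸴ Q₂ × (⊩ᵇ[ Q₁ ∣ ℬ ] Γ) × (⊩ᵇ[ Q₂ ∣ ℬ ] Δ))
    ⊩-⸴ = refl

    ⊩-sequent : ∀ {R Γ ψ} → (Γ ⊩[ R ∣ ℬ ] ψ) ≡ (∀ 𝒳 → ℬ ⊆ 𝒳 → ∀ U →
                ⊩ᵇ[ U ∣ 𝒳 ] Γ → ⊩ᶠ[ R [ U ] ∣ 𝒳 ] ψ)
    ⊩-sequent = refl

{-# OPTIONS --safe #-}
module Submission where

-- Let every subformula χ of Γ and φ be named by an atom χ♭, with p♭ = p for
-- atoms p and fresh atoms otherwise, and let ⌜_⌝ send each χ♭ back to χ.  Over the
-- base 𝒩 of all atomic rules whose decoding is admissible in NBI, and over its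
-- extensions, being supported at S is the same as S ⊢ χ♭ (`reify`, `reflect`).
-- Validity of Γ ▹ φ thus gives Γ♭ ⊢ φ♭ in 𝒩, which decodes to Γ ⊢ φ.

open import Defs
open import Data.List.Base using (List; []; _∷_; _++_; map)
open import Data.List.Extrema.Nat using (max; xs≤max)
open import Data.List.Membership.Propositional using () renaming (_∈_ to _∈ˡ_)
open import Data.List.Membership.Propositional.Properties using (∈-++⁺ˡ; ∈-++⁺ʳ; ∈-map⁺)
open import Data.List.Relation.Binary.Subset.Propositional using () renaming (_⊆_ to _⊆ˡ_)
open import Data.List.Relation.Unary.All as All using (All; []; _∷_)
open import Data.List.Relation.Unary.Any using (here; there)
open import Data.Nat.Base using (ℕ; zero; suc; _+_; _∸_; _<_; s≤s)
open import Data.Nat.Properties using (_<?_; m+n≮m; m+n∸m≡n)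
open import Data.Product using (∃; _,_; proj₂)
open import Function.Base using (_∘_; id)
open import Function.Bundles using (_↔_; module Inverse)
open import Level using (lift; lower)
open import Relation.Binary.Construct.Closure.Transitive using (_∷_) renaming ([_] to single)
open import Relation.Binary.PropositionalEquality
  using (_≡_; refl; sym; trans; cong; cong₂; subst; subst₂)
open import Relation.Nullary using (yes; no; contradiction)
open import Relation.Unary using (_⊆_)

-- Bunches: renaming of leaves, and bunch-extension

mapᵇ : ∀ {X Y} → (X → Y) → Bunch X → Bunch Y
mapᵇ f ⌞ x ⌟   = ⌞ f x ⌟
mapᵇ f ∅₊      = ∅₊
mapᵇ f ∅ₓ      = ∅ₓ
mapᵇ f (Γ ⨾ Δ) = mapᵇ f Γ ⨾ mapᵇ f Δ
mapᵇ f (Γ ⸴ Δ) = mapᵇ f Γ ⸴ mapᵇ f Δ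

mapᶜ : ∀ {X Y} → (X → Y) → Ctx X → Ctx Y
mapᶜ f ∙        = ∙
mapᶜ f (C ⨾ˡ Δ) = mapᶜ f C ⨾ˡ mapᵇ f Δ
mapᶜ f (C ⸴ˡ Δ) = mapᶜ f C ⸴ˡ mapᵇ f Δ
mapᶜ f (Δ ⨾ʳ C) = mapᵇ f Δ ⨾ʳ mapᶜ f C
mapᶜ f (Δ ⸴ʳ C) = mapᵇ f Δ ⸴ʳ mapᶜ f C

mapᵇ-[] : ∀ {X Y} (f : X → Y) C {Δ} → mapᵇ f (C [ Δ ]) ≡ mapᶜ f C [ mapᵇ f Δ ]
mapᵇ-[] f ∙        = refl
mapᵇ-[] f (C ⨾ˡ Δ) = cong (_⨾ mapᵇ f Δ) (mapᵇ-[] f C)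
mapᵇ-[] f (C ⸴ˡ Δ) = cong (_⸴ mapᵇ f Δ) (mapᵇ-[] f C)
mapᵇ-[] f (Δ ⨾ʳ C) = cong (mapᵇ f Δ ⨾_) (mapᵇ-[] f C)
mapᵇ-[] f (Δ ⸴ʳ C) = cong (mapᵇ f Δ ⸴_) (mapᵇ-[] f C)

mapᵇ-≈ : ∀ {X Y} (f : X → Y) {Γ Δ} → Γ ≈ Δ → mapᵇ f Γ ≈ mapᵇ f Δ
mapᵇ-≈ f ≈-refl        = ≈-refl
mapᵇ-≈ f (≈-sym e)     = ≈-sym (mapᵇ-≈ f e)
mapᵇ-≈ f (≈-trans d e) = ≈-trans (mapᵇ-≈ f d) (mapᵇ-≈ f e)
mapᵇ-≈ f ⨾-comm        = ⨾-comm
mapᵇ-≈ f ⨾-assoc       = ⨾-assoc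
mapᵇ-≈ f ⨾-unit        = ⨾-unit
mapᵇ-≈ f ⸴-comm        = ⸴-comm
mapᵇ-≈ f ⸴-assoc       = ⸴-assoc
mapᵇ-≈ f ⸴-unit        = ⸴-unit
mapᵇ-≈ f (≈-cong C e)  =
  subst₂ _≈_ (sym (mapᵇ-[] f C)) (sym (mapᵇ-[] f C)) (≈-cong (mapᶜ f C) (mapᵇ-≈ f e))

-- `≽` is only a transitive closure; reflexivity comes from extending by the additive unit.
≽-refl : ∀ {X} {Γ : Bunch X} → Γ ≽ Γ
≽-refl = single (extend ∙ ∅₊ (≈-sym ⨾-unit))

⨾-≽ˡ : ∀ {X} {Γ Δ : Bunch X} → Γ ⨾ Δ ≽ Γ
⨾-≽ˡ {Δ = Δ} = single (extend ∙ Δ ≈-refl)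

⨾-≽ʳ : ∀ {X} {Γ Δ : Bunch X} → Γ ⨾ Δ ≽ Δ
⨾-≽ʳ {Γ = Γ} = single (extend ∙ Γ ⨾-comm)

-- Admissible rules of NBI, and monotonicity of atomic derivability

module _ {𝔸 : Set} where

  -- NBI has no primitive cut; `∨-E` on the disjunction of `φ` with itself simulates it.
  ⊢-cut : ∀ (C : Ctx (Formula 𝔸)) {Δ φ χ} → Δ ⊢ φ → C [ ⌞ φ ⌟ ] ⊢ χ → C [ Δ ] ⊢ χ
  ⊢-cut C d e = ∨-E C e e (∨-I₁ d)

  ⌊_⌋ : Bunch (Formula 𝔸) → Formula 𝔸
  ⌊ ⌞ φ ⌟ ⌋ = φ
  ⌊ ∅₊ ⌋    = ⊤
  ⌊ ∅ₓ ⌋    = ⊤∗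
  ⌊ Γ ⨾ Δ ⌋ = ⌊ Γ ⌋ ∧ ⌊ Δ ⌋
  ⌊ Γ ⸴ Δ ⌋ = ⌊ Γ ⌋ ∗ ⌊ Δ ⌋

  ⊢-⌊⌋ : ∀ Γ → Γ ⊢ ⌊ Γ ⌋
  ⊢-⌊⌋ ⌞ φ ⌟   = ax
  ⊢-⌊⌋ ∅₊      = ⊤-I
  ⊢-⌊⌋ ∅ₓ      = ⊤∗-I
  ⊢-⌊⌋ (Γ ⨾ Δ) = ∧-I (⊢-⌊⌋ Γ) (⊢-⌊⌋ Δ)
  ⊢-⌊⌋ (Γ ⸴ Δ) = ∗-I (⊢-⌊⌋ Γ) (⊢-⌊⌋ Δ)

  -- The rule ⊥-E acts at the root only; inside a context the siblings of the
  -- hole are first moved into the conclusion by implications.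
  ⊥-E-ctx : ∀ (C : Ctx (Formula 𝔸)) {Δ χ} → Δ ⊢ ⊥ → C [ Δ ] ⊢ χ
  ⊥-E-ctx ∙        d = ⊥-E d
  ⊥-E-ctx (C ⨾ˡ Δ) d = ⇒-E (⊥-E-ctx C d) (⊢-⌊⌋ Δ)
  ⊥-E-ctx (C ⸴ˡ Δ) d = -∗-E (⊥-E-ctx C d) (⊢-⌊⌋ Δ)
  ⊥-E-ctx (Δ ⨾ʳ C) d = exch ⨾-comm (⇒-E (⊥-E-ctx C d) (⊢-⌊⌋ Δ))
  ⊥-E-ctx (Δ ⸴ʳ C) d = exch ⸴-comm (-∗-E (⊥-E-ctx C d) (⊢-⌊⌋ Δ))

  Derivable-mono : ∀ {ℬ 𝒳 : Base 𝔸} → ℬ ⊆ 𝒳 → ∀ {S p} → S ⊢⟨ ℬ ⟩ p → S ⊢⟨ 𝒳 ⟩ p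
  Derivable-mono ℬ⊆ ref          = ref
  Derivable-mono ℬ⊆ (rule r ds)  = rule (ℬ⊆ r) (λ i → Derivable-mono ℬ⊆ (ds i))
  Derivable-mono ℬ⊆ (weak P d)   = weak P (Derivable-mono ℬ⊆ d)
  Derivable-mono ℬ⊆ (contr P d)  = contr P (Derivable-mono ℬ⊆ d)
  Derivable-mono ℬ⊆ (exch P d e) = exch P (Derivable-mono ℬ⊆ d) e
  Derivable-mono ℬ⊆ (cut S d e)  = cut S (Derivable-mono ℬ⊆ d) (Derivable-mono ℬ⊆ e)

  Derivable-≽₁ : ∀ {ℬ : Base 𝔸} {S T p} → S ≽₁ T → T ⊢⟨ ℬ ⟩ p → S ⊢⟨ ℬ ⟩ p
  Derivable-≽₁ (extend C _ e) d = exch ∙ (weak C d) (≈-sym e)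

  Derivable-≽ : ∀ {ℬ : Base 𝔸} {S T p} → S ≽ T → T ⊢⟨ ℬ ⟩ p → S ⊢⟨ ℬ ⟩ p
  Derivable-≽ (single s) d = Derivable-≽₁ s d
  Derivable-≽ (s ∷ ss)   d = Derivable-≽₁ s (Derivable-≽ ss d)

-- Support and derivability over the base `𝒩`

module Decoding {𝔸 : Set} (⌜_⌝ : 𝔸 → Formula 𝔸) where

  ⌜_⌝ᵇ : Bunch 𝔸 → Bunch (Formula 𝔸)
  ⌜_⌝ᵇ = mapᵇ ⌜_⌝

  ⌜_⌝ᶜ : Ctx 𝔸 → Ctx (Formula 𝔸)
  ⌜_⌝ᶜ = mapᶜ ⌜_⌝

  Provable : AtomicSequent 𝔸 → Set
  Provable (P ▹ p) = ⌜ P ⌝ᵇ ⊢ ⌜ p ⌝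

  -- All rules that NBI admits under the decoding, not just the images of its
  -- primitive rules: soundness is then immediate.
  𝒩 : Base 𝔸
  𝒩 (prems ⟹ s) = All Provable prems → Provable s

  distrib : ∀ C {Δ χ} → ⌜ C [ Δ ] ⌝ᵇ ⊢ χ → ⌜ C ⌝ᶜ [ ⌜ Δ ⌝ᵇ ] ⊢ χ
  distrib C = subst (_⊢ _) (mapᵇ-[] ⌜_⌝ C)

  collect : ∀ C {Δ χ} → ⌜ C ⌝ᶜ [ ⌜ Δ ⌝ᵇ ] ⊢ χ → ⌜ C [ Δ ] ⌝ᵇ ⊢ χ
  collect C = subst (_⊢ _) (sym (mapᵇ-[] ⌜_⌝ C))

  soundness : ∀ {S p} → S ⊢⟨ 𝒩 ⟩ p → ⌜ S ⌝ᵇ ⊢ ⌜ p ⌝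
  soundness ref          = ax
  soundness (rule r ds)  = r (All.tabulate (λ i → soundness (ds i)))
  soundness (weak P d)   = collect P (weak ⌜ P ⌝ᶜ (distrib P (soundness d)))
  soundness (contr P d)  = collect P (contr ⌜ P ⌝ᶜ (distrib P (soundness d)))
  soundness (exch P d e) =
    collect P (exch (≈-cong ⌜ P ⌝ᶜ (≈-sym (mapᵇ-≈ ⌜_⌝ e))) (distrib P (soundness d)))
  soundness (cut S d e)  = collect S (⊢-cut ⌜ S ⌝ᶜ (soundness d) (distrib S (soundness e)))

  -- More than `⌜ c ⌝ ≡ φ` is recorded: immediate subformulae must have names too, and an atom is
  -- named only by itself, because its support is derivability of that very atom. The equations
  -- mention `⌜ a ⌝` and `⌜ b ⌝` so that NBI rules apply to decoded premisses as they stand.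
  data _names_ : 𝔸 → Formula 𝔸 → Set where
    atomⁿ : ∀ {p} → ⌜ p ⌝ ≡ atom p → p names atom p
    ⊤ⁿ    : ∀ {c} → ⌜ c ⌝ ≡ ⊤ → c names ⊤
    ⊥ⁿ    : ∀ {c} → ⌜ c ⌝ ≡ ⊥ → c names ⊥
    ⊤∗ⁿ   : ∀ {c} → ⌜ c ⌝ ≡ ⊤∗ → c names ⊤∗
    ∧ⁿ    : ∀ {a b c φ ψ} → ⌜ c ⌝ ≡ ⌜ a ⌝ ∧ ⌜ b ⌝ → a names φ → b names ψ → c names (φ ∧ ψ)
    ∨ⁿ    : ∀ {a b c φ ψ} → ⌜ c ⌝ ≡ ⌜ a ⌝ ∨ ⌜ b ⌝ → a names φ → b names ψ → c names (φ ∨ ψ)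
    ⇒ⁿ    : ∀ {a b c φ ψ} → ⌜ c ⌝ ≡ ⌜ a ⌝ ⇒ ⌜ b ⌝ → a names φ → b names ψ → c names (φ ⇒ ψ)
    ∗ⁿ    : ∀ {a b c φ ψ} → ⌜ c ⌝ ≡ ⌜ a ⌝ ∗ ⌜ b ⌝ → a names φ → b names ψ → c names (φ ∗ ψ)
    -∗ⁿ   : ∀ {a b c φ ψ} → ⌜ c ⌝ ≡ ⌜ a ⌝ -∗ ⌜ b ⌝ → a names φ → b names ψ → c names (φ -∗ ψ)

  names⇒≡ : ∀ {c φ} → c names φ → ⌜ c ⌝ ≡ φ
  names⇒≡ (atomⁿ e)   = e
  names⇒≡ (⊤ⁿ e)      = e
  names⇒≡ (⊥ⁿ e)      = e
  names⇒≡ (⊤∗ⁿ e)     = e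
  names⇒≡ (∧ⁿ e m n)  = trans e (cong₂ _∧_ (names⇒≡ m) (names⇒≡ n))
  names⇒≡ (∨ⁿ e m n)  = trans e (cong₂ _∨_ (names⇒≡ m) (names⇒≡ n))
  names⇒≡ (⇒ⁿ e m n)  = trans e (cong₂ _⇒_ (names⇒≡ m) (names⇒≡ n))
  names⇒≡ (∗ⁿ e m n)  = trans e (cong₂ _∗_ (names⇒≡ m) (names⇒≡ n))
  names⇒≡ (-∗ⁿ e m n) = trans e (cong₂ _-∗_ (names⇒≡ m) (names⇒≡ n))

  Derived : Base 𝔸 → AtomicSequent 𝔸 → Set
  Derived 𝒳 (P ▹ p) = P ⊢⟨ 𝒳 ⟩ p

  -- Membership in `𝒩` is by definition such a function, so an NBI argument serves directly as the
  -- atomic rule being applied.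
  infer : ∀ {𝒳 prems P p} → 𝒩 ⊆ 𝒳 → (All Provable prems → Provable (P ▹ p)) →
          All (Derived 𝒳) prems → P ⊢⟨ 𝒳 ⟩ p
  infer 𝒩⊆ r ds = rule (𝒩⊆ r) (All.lookup ds)

  private
    fold : ∀ {c Γ φ} → ⌜ c ⌝ ≡ φ → Γ ⊢ φ → Γ ⊢ ⌜ c ⌝
    fold e = subst (_ ⊢_) (sym e)

    unfold : ∀ {c Γ φ} → ⌜ c ⌝ ≡ φ → Γ ⊢ ⌜ c ⌝ → Γ ⊢ φ
    unfold e = subst (_ ⊢_) e

  -- Simultaneous induction on the naming: the antecedent of an implication switches direction. `𝒳`
  -- is an arbitrary extension of `𝒩` because the support clauses pass to larger bases.
  reify   : ∀ {c φ 𝒳 S} → c names φ → 𝒩 ⊆ 𝒳 → ⟦ φ ⟧ᶠ 𝒳 S → S ⊢⟨ 𝒳 ⟩ c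
  reflect : ∀ {c φ 𝒳 S} → c names φ → 𝒩 ⊆ 𝒳 → S ⊢⟨ 𝒳 ⟩ c → ⟦ φ ⟧ᶠ 𝒳 S

  reify (atomⁿ _) 𝒩⊆ s = lower s
  -- For `⊤`, `⊤∗`, `∧`, `∨` and `∗`, the clause is taken at the context `∙` and the atom `c`
  -- itself, which leaves just an introduction rule to apply.
  reify {c} (⊤ⁿ e) 𝒩⊆ s =
    lower (s _ id ∙ c (lift (infer 𝒩⊆ (λ { [] → fold e ⊤-I }) [])))
  reify {c} (⊥ⁿ _) 𝒩⊆ s = lower (s ∙ c)
  reify {c} (⊤∗ⁿ e) 𝒩⊆ s =
    lower (s _ id ∙ c (lift (infer 𝒩⊆ (λ { [] → fold e ⊤∗-I }) [])))
  reify {c} (∧ⁿ e m n) 𝒩⊆ s =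
    -- Both conjuncts are derived from the same bunch, so `∧-I` yields two copies of it, merged by
    -- contraction.
    lower (s _ id ∙ c λ _ 𝒳⊆ _ (_ , _ , e₁ , e₂ , s₁ , s₂) → lift (contr ∙
      (infer (𝒳⊆ ∘ 𝒩⊆) (λ { (d₁ ∷ d₂ ∷ []) → fold e (∧-I d₁ d₂) })
        (Derivable-≽ e₁ (reify m (𝒳⊆ ∘ 𝒩⊆) s₁) ∷ Derivable-≽ e₂ (reify n (𝒳⊆ ∘ 𝒩⊆) s₂) ∷ []))))
  reify {c} (∨ⁿ e m n) 𝒩⊆ s =
    lower (s _ id ∙ c
      (λ _ 𝒳⊆ _ s₁ → lift (infer (𝒳⊆ ∘ 𝒩⊆) (λ { (d ∷ []) → fold e (∨-I₁ d) })
        (reify m (𝒳⊆ ∘ 𝒩⊆) s₁ ∷ [])))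
      (λ _ 𝒳⊆ _ s₂ → lift (infer (𝒳⊆ ∘ 𝒩⊆) (λ { (d ∷ []) → fold e (∨-I₂ d) })
        (reify n (𝒳⊆ ∘ 𝒩⊆) s₂ ∷ []))))
  reify (⇒ⁿ e m n) 𝒩⊆ s =
    infer 𝒩⊆ (λ { (d ∷ []) → fold e (⇒-I d) })
      -- The antecedent is supported at its own name, which puts that name beside `S` as `⇒-I`
      -- requires.
      (reify n 𝒩⊆ (s _ id _ (reflect m 𝒩⊆ ref)) ∷ [])
  reify {c} (∗ⁿ e m n) 𝒩⊆ s =
    lower (s _ id ∙ c λ _ 𝒳⊆ _ (_ , _ , e₁₂ , s₁ , s₂) → lift (Derivable-≽ e₁₂
      (infer (𝒳⊆ ∘ 𝒩⊆) (λ { (d₁ ∷ d₂ ∷ []) → fold e (∗-I d₁ d₂) })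
        (reify m (𝒳⊆ ∘ 𝒩⊆) s₁ ∷ reify n (𝒳⊆ ∘ 𝒩⊆) s₂ ∷ []))))
  reify (-∗ⁿ e m n) 𝒩⊆ s =
    infer 𝒩⊆ (λ { (d ∷ []) → fold e (-∗-I d) })
      (reify n 𝒩⊆ (s _ id _ (reflect m 𝒩⊆ ref)) ∷ [])

  reflect (atomⁿ _) 𝒩⊆ d = lift d
  -- For given `U` and `p`, the whole elimination step is a single rule of `𝒩`; any `p` will do, as
  -- every atom decodes to some formula.
  reflect (⊤ⁿ e) 𝒩⊆ d _ 𝒳⊆ U p u = lift
    (infer (𝒳⊆ ∘ 𝒩⊆)
      (λ { (d₁ ∷ d₂ ∷ []) → collect U (⊤-E ⌜ U ⌝ᶜ (distrib U d₁) (unfold e d₂)) })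
      (lower u ∷ Derivable-mono 𝒳⊆ d ∷ []))
  reflect (⊥ⁿ e) 𝒩⊆ d U p = lift
    (infer 𝒩⊆ (λ { (d₁ ∷ []) → collect U (⊥-E-ctx ⌜ U ⌝ᶜ (unfold e d₁)) }) (d ∷ []))
  reflect (⊤∗ⁿ e) 𝒩⊆ d _ 𝒳⊆ U p u = lift
    (infer (𝒳⊆ ∘ 𝒩⊆)
      (λ { (d₁ ∷ d₂ ∷ []) → collect U (⊤∗-E ⌜ U ⌝ᶜ (distrib U d₁) (unfold e d₂)) })
      (lower u ∷ Derivable-mono 𝒳⊆ d ∷ []))
  reflect (∧ⁿ {a} {b} e m n) 𝒩⊆ d _ 𝒳⊆ U p u = lift
    (infer (𝒳⊆ ∘ 𝒩⊆)
      (λ { (d₁ ∷ d₂ ∷ []) → collect U (∧-E ⌜ U ⌝ᶜ (distrib U d₁) (unfold e d₂)) })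
      -- Of all the bunches that `u` covers, only the one made of the two names is needed: it gives
      -- the minor premiss of `∧-E`.
      (lower (u _ id (⌞ a ⌟ ⨾ ⌞ b ⌟) (_ , _ , ⨾-≽ˡ , ⨾-≽ʳ ,
          reflect m (𝒳⊆ ∘ 𝒩⊆) ref , reflect n (𝒳⊆ ∘ 𝒩⊆) ref))
        ∷ Derivable-mono 𝒳⊆ d ∷ []))
  reflect (∨ⁿ {a} {b} e m n) 𝒩⊆ d _ 𝒳⊆ U p u v = lift
    (infer (𝒳⊆ ∘ 𝒩⊆)
      (λ { (d₁ ∷ d₂ ∷ d₃ ∷ []) →
           collect U (∨-E ⌜ U ⌝ᶜ (distrib U d₁) (distrib U d₂) (unfold e d₃)) })
      (lower (u _ id ⌞ a ⌟ (reflect m (𝒳⊆ ∘ 𝒩⊆) ref))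
        ∷ lower (v _ id ⌞ b ⌟ (reflect n (𝒳⊆ ∘ 𝒩⊆) ref))
        ∷ Derivable-mono 𝒳⊆ d ∷ []))
  -- `reify` turns support of the antecedent into a derivation of its name, and `⇒-E` then gives the
  -- name of the consequent.
  reflect (⇒ⁿ e m n) 𝒩⊆ d _ 𝒳⊆ U u = reflect n (𝒳⊆ ∘ 𝒩⊆)
    (infer (𝒳⊆ ∘ 𝒩⊆) (λ { (d₁ ∷ d₂ ∷ []) → ⇒-E (unfold e d₁) d₂ })
      (Derivable-mono 𝒳⊆ d ∷ reify m (𝒳⊆ ∘ 𝒩⊆) u ∷ []))
  reflect (∗ⁿ {a} {b} e m n) 𝒩⊆ d _ 𝒳⊆ U p u = lift
    (infer (𝒳⊆ ∘ 𝒩⊆)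
      (λ { (d₁ ∷ d₂ ∷ []) → collect U (∗-E ⌜ U ⌝ᶜ (distrib U d₁) (unfold e d₂)) })
      (lower (u _ id (⌞ a ⌟ ⸴ ⌞ b ⌟) (_ , _ , ≽-refl ,
          reflect m (𝒳⊆ ∘ 𝒩⊆) ref , reflect n (𝒳⊆ ∘ 𝒩⊆) ref))
        ∷ Derivable-mono 𝒳⊆ d ∷ []))
  reflect (-∗ⁿ e m n) 𝒩⊆ d _ 𝒳⊆ U u = reflect n (𝒳⊆ ∘ 𝒩⊆)
    (infer (𝒳⊆ ∘ 𝒩⊆) (λ { (d₁ ∷ d₂ ∷ []) → -∗-E (unfold e d₁) d₂ })
      (Derivable-mono 𝒳⊆ d ∷ reify m (𝒳⊆ ∘ 𝒩⊆) u ∷ []))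

  -- Names for bunches, and completeness relative to a naming

  data _namesᵇ_ : Bunch 𝔸 → Bunch (Formula 𝔸) → Set where
    ⌞_⌟ⁿ : ∀ {a φ} → a names φ → ⌞ a ⌟ namesᵇ ⌞ φ ⌟
    ∅₊ⁿ  : ∅₊ namesᵇ ∅₊
    ∅ₓⁿ  : ∅ₓ namesᵇ ∅ₓ
    _⨾ⁿ_ : ∀ {S T Γ Δ} → S namesᵇ Γ → T namesᵇ Δ → (S ⨾ T) namesᵇ (Γ ⨾ Δ)
    _⸴ⁿ_ : ∀ {S T Γ Δ} → S namesᵇ Γ → T namesᵇ Δ → (S ⸴ T) namesᵇ (Γ ⸴ Δ)

  namesᵇ⇒≡ : ∀ {S Γ} → S namesᵇ Γ → ⌜ S ⌝ᵇ ≡ Γ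
  namesᵇ⇒≡ ⌞ n ⌟ⁿ   = cong ⌞_⌟ (names⇒≡ n)
  namesᵇ⇒≡ ∅₊ⁿ      = refl
  namesᵇ⇒≡ ∅ₓⁿ      = refl
  namesᵇ⇒≡ (m ⨾ⁿ n) = cong₂ _⨾_ (namesᵇ⇒≡ m) (namesᵇ⇒≡ n)
  namesᵇ⇒≡ (m ⸴ⁿ n) = cong₂ _⸴_ (namesᵇ⇒≡ m) (namesᵇ⇒≡ n)

  -- Leaves are `reflect` applied to `ref`; an additive pair extends each of its halves, so the
  -- halves are the witnesses.
  namesᵇ⇒⊩ : ∀ {S Γ 𝒳} → S namesᵇ Γ → 𝒩 ⊆ 𝒳 → ⟦ Γ ⟧ᵇ 𝒳 S
  namesᵇ⇒⊩ ⌞ n ⌟ⁿ   𝒩⊆ = reflect n 𝒩⊆ ref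
  namesᵇ⇒⊩ ∅₊ⁿ      𝒩⊆ = _
  namesᵇ⇒⊩ ∅ₓⁿ      𝒩⊆ = lift ≽-refl
  namesᵇ⇒⊩ (m ⨾ⁿ n) 𝒩⊆ = _ , _ , ⨾-≽ˡ , ⨾-≽ʳ , namesᵇ⇒⊩ m 𝒩⊆ , namesᵇ⇒⊩ n 𝒩⊆
  namesᵇ⇒⊩ (m ⸴ⁿ n) 𝒩⊆ = _ , _ , ≽-refl , namesᵇ⇒⊩ m 𝒩⊆ , namesᵇ⇒⊩ n 𝒩⊆

  completeness : ∀ {S c Γ φ} → S namesᵇ Γ → c names φ → Γ ⊩ φ → Γ ⊢ φ
  completeness m n valid = subst₂ _⊢_ (namesᵇ⇒≡ m) (names⇒≡ n)
    (soundness (reify n id (valid 𝒩 𝒩 id _ (namesᵇ⇒⊩ m id))))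

-- Construction of the naming

subformulas : ∀ {𝔸} → Formula 𝔸 → List (Formula 𝔸)
subformulas (atom p)   = atom p ∷ []
subformulas ⊤          = ⊤ ∷ []
subformulas ⊥          = ⊥ ∷ []
subformulas ⊤∗         = ⊤∗ ∷ []
subformulas χ@(φ ∧ ψ)  = χ ∷ subformulas φ ++ subformulas ψ
subformulas χ@(φ ∨ ψ)  = χ ∷ subformulas φ ++ subformulas ψ
subformulas χ@(φ ⇒ ψ)  = χ ∷ subformulas φ ++ subformulas ψ
subformulas χ@(φ ∗ ψ)  = χ ∷ subformulas φ ++ subformulas ψ
subformulas χ@(φ -∗ ψ) = χ ∷ subformulas φ ++ subformulas ψ

subformulasᵇ : ∀ {𝔸} → Bunch (Formula 𝔸) → List (Formula 𝔸)
subformulasᵇ ⌞ φ ⌟   = subformulas φ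
subformulasᵇ ∅₊      = []
subformulasᵇ ∅ₓ      = []
subformulasᵇ (Γ ⨾ Δ) = subformulasᵇ Γ ++ subformulasᵇ Δ
subformulasᵇ (Γ ⸴ Δ) = subformulasᵇ Γ ++ subformulasᵇ Δ

nth : ∀ {A : Set} → A → List A → ℕ → A
nth d []       _       = d
nth d (x ∷ xs) zero    = x
nth d (x ∷ xs) (suc n) = nth d xs n

∈⇒nth : ∀ {A : Set} {d x : A} {xs} → x ∈ˡ xs → ∃ λ n → nth d xs n ≡ x
∈⇒nth (here refl) = zero , refl
∈⇒nth (there x∈) with n , e ← ∈⇒nth x∈ = suc n , e

-- The atoms occurring in L lie below `bound` and decode to themselves; the
-- atom with number `bound + n` decodes to the n-th formula of L (⊤ past the end).
module Naming {𝔸 : Set} (𝔸↔ℕ : 𝔸 ↔ ℕ) (L : List (Formula 𝔸)) where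

  open Inverse 𝔸↔ℕ using (to; from; strictlyInverseˡ; strictlyInverseʳ)

  -- The value 0 on non-atoms is a harmless default, since only an upper bound for the atoms is
  -- wanted.
  atomNumber : Formula 𝔸 → ℕ
  atomNumber (atom p) = to p
  atomNumber _        = 0

  bound : ℕ
  bound = suc (max 0 (map atomNumber L))

  atom∈⇒<bound : ∀ {p} → atom p ∈ˡ L → to p < bound
  atom∈⇒<bound p∈ = s≤s (All.lookup (xs≤max 0 (map atomNumber L)) (∈-map⁺ atomNumber p∈))

  decode : ℕ → Formula 𝔸
  decode n with n <? bound
  ... | yes _ = atom (from n)
  ... | no  _ = nth ⊤ L (n ∸ bound)

  decode-< : ∀ {n} → n < bound → decode n ≡ atom (from n)
  decode-< {n} n< with n <? bound
  ... | yes _  = refl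
  ... | no  n≮ = contradiction n< n≮

  decode-+ : ∀ n → decode (bound + n) ≡ nth ⊤ L n
  decode-+ n with bound + n <? bound
  ... | yes lt = contradiction lt (m+n≮m bound n)
  ... | no  _  = cong (nth ⊤ L) (m+n∸m≡n bound n)

  open Decoding (decode ∘ to)

  ∈⇒decoded : ∀ {φ} → φ ∈ˡ L → ∃ λ c → decode (to c) ≡ φ
  ∈⇒decoded φ∈ with n , e ← ∈⇒nth φ∈ =
    from (bound + n) , trans (cong decode (strictlyInverseˡ (bound + n))) (trans (decode-+ n) e)

  name : ∀ φ → subformulas φ ⊆ˡ L → ∃ (_names φ)

  -- The common step for the five binary connectives, with `⊙ⁿ` the matching constructor of
  -- `_names_`.
  name₂ : ∀ φ ψ (_⊙_ : Formula 𝔸 → Formula 𝔸 → Formula 𝔸) →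
          (φ ⊙ ψ) ∷ subformulas φ ++ subformulas ψ ⊆ˡ L →
          (∀ {a b c} → decode (to c) ≡ decode (to a) ⊙ decode (to b) →
            a names φ → b names ψ → c names (φ ⊙ ψ)) →
          ∃ (_names (φ ⊙ ψ))
  name₂ φ ψ _⊙_ ⊆L ⊙ⁿ
    with c , e ← ∈⇒decoded (⊆L (here refl))
       | _ , m ← name φ (⊆L ∘ there ∘ ∈-++⁺ˡ)
       | _ , n ← name ψ (⊆L ∘ there ∘ ∈-++⁺ʳ (subformulas φ))
    = c , ⊙ⁿ (trans e (sym (cong₂ _⊙_ (names⇒≡ m) (names⇒≡ n)))) m n

  -- Some atom from `bound` on also decodes to `atom p`, but `p` must be named by itself.
  name (atom p) ⊆L = p ,
    atomⁿ (trans (decode-< (atom∈⇒<bound (⊆L (here refl)))) (cong atom (strictlyInverseʳ p)))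
  name ⊤  ⊆L with c , e ← ∈⇒decoded (⊆L (here refl)) = c , ⊤ⁿ e
  name ⊥  ⊆L with c , e ← ∈⇒decoded (⊆L (here refl)) = c , ⊥ⁿ e
  name ⊤∗ ⊆L with c , e ← ∈⇒decoded (⊆L (here refl)) = c , ⊤∗ⁿ e
  name (φ ∧ ψ)  ⊆L = name₂ φ ψ _∧_  ⊆L ∧ⁿ
  name (φ ∨ ψ)  ⊆L = name₂ φ ψ _∨_  ⊆L ∨ⁿ
  name (φ ⇒ ψ)  ⊆L = name₂ φ ψ _⇒_  ⊆L ⇒ⁿ
  name (φ ∗ ψ)  ⊆L = name₂ φ ψ _∗_  ⊆L ∗ⁿ
  name (φ -∗ ψ) ⊆L = name₂ φ ψ _-∗_ ⊆L -∗ⁿ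

  nameᵇ : ∀ Γ → subformulasᵇ Γ ⊆ˡ L → ∃ (_namesᵇ Γ)
  nameᵇ ⌞ φ ⌟ ⊆L with c , n ← name φ ⊆L = ⌞ c ⌟ , ⌞ n ⌟ⁿ
  nameᵇ ∅₊ ⊆L = ∅₊ , ∅₊ⁿ
  nameᵇ ∅ₓ ⊆L = ∅ₓ , ∅ₓⁿ
  nameᵇ (Γ ⨾ Δ) ⊆L
    with S , m ← nameᵇ Γ (⊆L ∘ ∈-++⁺ˡ) | T , n ← nameᵇ Δ (⊆L ∘ ∈-++⁺ʳ (subformulasᵇ Γ))
    = (S ⨾ T) , m ⨾ⁿ n
  nameᵇ (Γ ⸴ Δ) ⊆L
    with S , m ← nameᵇ Γ (⊆L ∘ ∈-++⁺ˡ) | T , n ← nameᵇ Δ (⊆L ∘ ∈-++⁺ʳ (subformulasᵇ Γ))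
    = (S ⸴ T) , m ⸴ⁿ n

theorem6p1 : (𝔸 : Set) → 𝔸 ↔ ℕ → (Γ : Bunch (Formula 𝔸)) (φ : Formula 𝔸) → Γ ⊩ φ → Γ ⊢ φ
theorem6p1 𝔸 𝔸↔ℕ Γ φ =
  completeness (proj₂ (nameᵇ Γ ∈-++⁺ˡ)) (proj₂ (name φ (∈-++⁺ʳ (subformulasᵇ Γ))))
  where
  -- One list for both sides of the sequent, so that a single decoding serves `Γ` and `φ`.
  open Naming 𝔸↔ℕ (subformulasᵇ Γ ++ subformulas φ)
  open Decoding (decode ∘ Inverse.to 𝔸↔ℕ)
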